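{- (i) $(\mathcal{N},=)\models\forall\mathsf{x}\forall\mathsf{y}[\neg\neg(\mathsf{x}=\mathsf{y})\rightarrow\mathsf{x}=\mathsf{y}]$. (ii) $(\mathcal{N},\sim_V)\models\forall\mathsf{x}\,\neg\forall\mathsf{y}[\neg\neg(\mathsf{x}=\mathsf{y})\rightarrow\mathsf{x}=\mathsf{y}]$, i.e. for every $\gamma\in\mathcal{N}$ it is not the case that $\forall\alpha[\neg\neg(\gamma\sim_V\alpha)\rightarrow\gamma\sim_V\alpha]$.
   Context: Intuitionistic mathematics (constructive reading of logical constants; Markov's Principle not assumed), with Brouwer's Continuity Principle as an axiom (for every $R\subseteq\mathcal{N}\times\omega$, if $\forall\alpha\exists n[\alpha Rn]$ then $\forall\alpha\exists m\exists n\forall\beta[\overline{\alpha}m\sqsubset\beta\rightarrow\beta Rn]$, where $\overline{\alpha}m=\langle\alpha(0),\dots,\alpha(m-1)\rangle$ and $\sqsubset$ is "initial segment of"). $\mathcal{N}=\omega^\omega$. The Vitali equivalence relation: $\alpha\sim_V\beta$ iff $\exists n\forall m>n[\alpha(m)=\beta(m)]$. In $(\mathcal{N},E)$ the symbol $=$ is interpreted by the relation $E$; satisfaction read intuitionistically. -}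

module Defs where

open import Data.Empty using (⊥)
open import Data.Fin.Base using (Fin)
open import Data.Irrelevant using (Irrelevant)
open import Data.List.Base using (List; applyUpTo; length)
open import Data.Nat.Base using (ℕ; suc; _>_)
open import Data.Product.Base using (Σ; _×_)
open import Data.Sum.Base using (_⊎_)
open import Data.Vec.Base using (Vec; []; _∷_; lookup)
open import Level using (0ℓ)
open import Relation.Binary.Core using (Rel; REL)
open import Relation.Binary.PropositionalEquality.Core using (_≡_)

infix  6 _≐_
infixr 5 ¬̇_
infixr 4 _∧̇_
infixr 3 _∨̇_
infixr 2 _⇒̇_
infixr 1 ∀̇_ ∃̇_
infix  0 _⊨_
infix  4 _⊏_ _=ₙ_ _∼ⱽ_

-- Intuitionistic ∃ and ∨ are Σ and ⊎ under the bracket type `Irrelevant`.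
-- The brackets are essential: with a bare Σ, from which the witness can be
-- projected as a function of the parameters, the Continuity Principle below
-- is refutable (Escardó–Xu) and every consequence of it would be vacuous.

Exists : {A : Set} → (A → Set) → Set
Exists {A} P = Irrelevant (Σ A P)

_Or_ : Set → Set → Set
A Or B = Irrelevant (A ⊎ B)

-- First-order formulas over the signature with equality only, with n free
-- variables; de Bruijn indices, 0 being the innermost bound variable.

data Formula (n : ℕ) : Set where
  _≐_            : Fin n → Fin n → Formula n
  ⊥̇              : Formula n
  _∧̇_ _∨̇_ _⇒̇_    : Formula n → Formula n → Formula n
  ∀̇_ ∃̇_          : Formula (suc n) → Formula n

¬̇_ : ∀ {n} → Formula n → Formula n
¬̇ φ = φ ⇒̇ ⊥̇

record Structure : Set₁ where
  constructor ⟨_,_⟩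
  field
    Carrier : Set
    _≈_     : Rel Carrier 0ℓ

Sat : ∀ {n} (𝔄 : Structure) → Vec (Structure.Carrier 𝔄) n → Formula n → Set
Sat 𝔄 ρ (i ≐ j)  = Structure._≈_ 𝔄 (lookup ρ i) (lookup ρ j)
Sat 𝔄 ρ ⊥̇        = ⊥
Sat 𝔄 ρ (φ ∧̇ ψ)  = Sat 𝔄 ρ φ × Sat 𝔄 ρ ψ
Sat 𝔄 ρ (φ ∨̇ ψ)  = Sat 𝔄 ρ φ Or Sat 𝔄 ρ ψ
Sat 𝔄 ρ (φ ⇒̇ ψ)  = Sat 𝔄 ρ φ → Sat 𝔄 ρ ψ
Sat 𝔄 ρ (∀̇ φ)    = (a : Structure.Carrier 𝔄) → Sat 𝔄 (a ∷ ρ) φ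
Sat 𝔄 ρ (∃̇ φ)    = Exists λ (a : Structure.Carrier 𝔄) → Sat 𝔄 (a ∷ ρ) φ

_⊨_ : Structure → Formula 0 → Set
𝔄 ⊨ φ = Sat 𝔄 [] φ

𝓝 : Set
𝓝 = ℕ → ℕ

-- Equality of infinite sequences is extensional.
_=ₙ_ : Rel 𝓝 0ℓ
α =ₙ β = ∀ n → α n ≡ β n

_∼ⱽ_ : Rel 𝓝 0ℓ
α ∼ⱽ β = Exists λ n → ∀ m → m > n → α m ≡ β m

-- ⟨α(0),…,α(m−1)⟩
initial : 𝓝 → ℕ → List ℕ
initial = applyUpTo

_⊏_ : List ℕ → 𝓝 → Set
s ⊏ β = s ≡ initial β (length s)

-- A subset of 𝓝 × ω is given by a family R of types, (α , n) belonging to it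
-- when R α n is inhabited in the bracketed sense.
ContinuityPrinciple : Set₁
ContinuityPrinciple =
  (R : REL 𝓝 ℕ 0ℓ) →
  (∀ α → Exists λ n → Irrelevant (R α n)) →
  ∀ α → Exists λ m → Exists λ n → ∀ β → initial α m ⊏ β → Irrelevant (R β n)

{-# OPTIONS --safe #-}

-- Part (ii): for any β, let `bumped γ β` be γ with β k added at the least k such
-- that β k is nonzero, if there is one.  It differs from γ in at most one place,
-- so it cannot fail to be Vitali equivalent to γ; but a bound on that place is not
-- a continuous function of β.  Indeed, near the zero sequence such a bound n would
-- hold for all β beginning with m zeros, in particular for the sequence whose only
-- nonzero value is at m + (n + 1).

module Submission where

open import Defs
open import Data.Fin using (#_)
open import Data.Irrelevant using (Irrelevant; [_]; map; pure)
open import Data.List.Base using (_∷_)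
open import Data.Nat.Base using (ℕ; zero; suc; _+_; _≤_; _<_; _>_; s≤s)
open import Data.Nat.ListAction using (sum)
open import Data.Nat.Properties using (_≟_; ≤-trans; m≤m+n; m≤n+m; n≤0⇒n≡0; 1+n≢n)
open import Data.Product.Base using (_×_; _,_; map₂)
open import Function.Base using (const; _∘_)
open import Relation.Binary.PropositionalEquality using (_≡_; refl; sym; trans; cong; subst; _≢_)
open import Relation.Nullary.Decidable using (decidable-stable)
open import Relation.Nullary.Negation using (¬_; ¬¬-map; contradiction; contradiction-irr)

-- A bracketed witness may be used here because the goal is `⊥`.
¬-Irrelevant : {A : Set} → ¬ A → ¬ Irrelevant A
¬-Irrelevant ¬a [ a ] = contradiction-irr a ¬a

=ₙ-stable : ∀ α β → ¬ ¬ (α =ₙ β) → α =ₙ β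
=ₙ-stable α β ¬¬α=β n = decidable-stable (α n ≟ β n) (¬¬-map (λ α=β → α=β n) ¬¬α=β)

value≤sum-initial : ∀ β {k m} → k < m → β k ≤ sum (initial β m)
value≤sum-initial β {zero}  {suc m} _         = m≤m+n (β 0) _
value≤sum-initial β {suc k} {suc m} (s≤s k<m) =
  ≤-trans (value≤sum-initial (β ∘ suc) k<m) (m≤n+m _ (β 0))

unlessPositive : ℕ → ℕ → ℕ
unlessPositive zero    x = x
unlessPositive (suc _) x = 0

unlessPositive-zeroʳ : ∀ s → unlessPositive s 0 ≡ 0
unlessPositive-zeroʳ zero    = refl
unlessPositive-zeroʳ (suc _) = refl

unlessPositive-positive : ∀ {s} x → s ≢ 0 → unlessPositive s x ≡ 0
unlessPositive-positive {zero}  x s≢0 = contradiction refl s≢0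
unlessPositive-positive {suc _} x _   = refl

-- The sum vanishes exactly when all values of `β` before `k` do, so it serves as a decidable guard.
bumped : 𝓝 → 𝓝 → 𝓝
bumped γ β k = unlessPositive (sum (initial β k)) (β k) + γ k

bumped-unchanged : ∀ γ β k → unlessPositive (sum (initial β k)) (β k) ≡ 0 → γ k ≡ bumped γ β k
bumped-unchanged γ β k eq = cong (_+ γ k) (sym eq)

AgreeAfter : 𝓝 → 𝓝 → ℕ → Set
AgreeAfter α β n = ∀ m → m > n → α m ≡ β m

bumped-agreeAfter-nonzero : ∀ γ β k → β k ≢ 0 → AgreeAfter γ (bumped γ β) k
bumped-agreeAfter-nonzero γ β k βk≢0 m k<m =
  bumped-unchanged γ β m (unlessPositive-positive (β m) λ sum≡0 →
    βk≢0 (n≤0⇒n≡0 (subst (β k ≤_) sum≡0 (value≤sum-initial β k<m))))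

-- Any nonzero `β k` would yield the bound `k`, refuting `γ≁`; so `β` is zero everywhere, nothing is
-- added, and `0` is a bound.
¬¬∼ⱽ-bumped : ∀ γ β → ¬ ¬ (γ ∼ⱽ bumped γ β)
¬¬∼ⱽ-bumped γ β γ≁ = γ≁ [ 0 , (λ m _ → bumped-unchanged γ β m (unchanged m)) ]
  where
  β≡0 : ∀ k → β k ≡ 0
  β≡0 k = decidable-stable (β k ≟ 0) λ βk≢0 →
    γ≁ [ k , bumped-agreeAfter-nonzero γ β k βk≢0 ]

  unchanged : ∀ m → unlessPositive (sum (initial β m)) (β m) ≡ 0
  unchanged m = trans (cong (unlessPositive _) (β≡0 m)) (unlessPositive-zeroʳ (sum (initial β m)))

spike : ℕ → 𝓝
spike zero    zero    = 1
spike zero    (suc _) = 0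
spike (suc N) zero    = 0
spike (suc N) (suc k) = spike N k

zeros⊏spike : ∀ m n → initial (const 0) m ⊏ spike (m + n)
zeros⊏spike zero    n = refl
zeros⊏spike (suc m) n = cong (0 ∷_) (zeros⊏spike m n)

-- Dropping the leading zero of `spike (suc N)` leaves the expression definitionally unchanged.
spike-bump : ∀ N → unlessPositive (sum (initial (spike N) N)) (spike N N) ≡ 1
spike-bump zero    = refl
spike-bump (suc N) = spike-bump N

bumped-spike-differs : ∀ γ N → γ N ≢ bumped γ (spike N) N
bumped-spike-differs γ N eq = 1+n≢n (sym (trans eq (cong (_+ γ N) (spike-bump N))))

¬-∼ⱽ-stable : ContinuityPrinciple → ∀ γ → ¬ (∀ α → ¬ ¬ (γ ∼ⱽ α) → γ ∼ⱽ α)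
¬-∼ⱽ-stable continuity γ stable =
  ¬-Irrelevant
    (λ (m , bound) → ¬-Irrelevant
      (λ (n , agree) → ¬-Irrelevant
        -- The summand `m` keeps the spike in the neighbourhood of zero; `suc n` puts it strictly
        -- past the bound.
        (λ agreeAfter → bumped-spike-differs γ (m + suc n)
          (agreeAfter (m + suc n) (m≤n+m (suc n) m)))
        (agree (spike (m + suc n)) (zeros⊏spike m (suc n))))
      bound)
    (continuity (λ β → AgreeAfter γ (bumped γ β))
      -- Assumed stability supplies a bound for every `β`; `pure` adds the inner bracket.
      (λ β → map (map₂ pure) (stable (bumped γ β) (¬¬∼ⱽ-bumped γ β)))
      (const 0))

theorem9p2 : ContinuityPrinciple →
    (⟨ 𝓝 , _=ₙ_ ⟩ ⊨ ∀̇ (∀̇ (¬̇ (¬̇ (# 1 ≐ # 0)) ⇒̇ (# 1 ≐ # 0))))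
    × (⟨ 𝓝 , _∼ⱽ_ ⟩ ⊨ ∀̇ (¬̇ (∀̇ (¬̇ (¬̇ (# 1 ≐ # 0)) ⇒̇ (# 1 ≐ # 0)))))
theorem9p2 continuity = =ₙ-stable , ¬-∼ⱽ-stable continuity
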